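{- Let $S$ be the free semigroup on countably many generators, enumerated as $\vec{s}=(s_n)_{n\in\omega}$. Every very strongly productive ultrafilter on $S$ is multiplicatively isomorphic to an ordered union ultrafilter, and hence is sparse.
   Context: For a sequence $\vec{x}=(x_n)_{n\in\omega}$ in $S$, $\mathrm{FP}(\vec{x})$ is the set of products $\prod_{i\in a}x_i$ (increasing order of indices), $a$ a finite nonempty subset of $\omega$. A sequence $\vec{y}$ is a product subsystem of $\vec{x}$ if there are finite nonempty $a_n\subseteq\omega$ with $\max a_n<\min a_{n+1}$ and $y_n=\prod_{i\in a_n}x_i$ for all $n$. An ultrafilter $p$ on $S$ is very strongly productive if every $A\in p$ contains some $\mathrm{FP}(\vec{x})\in p$ with $\vec{x}$ a product subsystem of $\vec{s}$. $\mathbb{F}$ is the partial semigroup of finite nonempty subsets of $\omega$ with $ab=a\cup b$ defined iff $\max a<\min b$; an ordered union ultrafilter is an ultrafilter $\mathcal{U}$ on $\mathbb{F}$ such that every member contains some $\mathrm{FP}(\vec{b})\in\mathcal{U}$ for a sequence $\vec{b}$ in $\mathbb{F}$ with $\max b_i<\min b_{i+1}$. $p$ is multiplicatively isomorphic to an ordered union ultrafilter if for some sequence $\vec{x}$ in $S$ the map $f:\mathbb{F}\to\mathrm{FP}(\vec{x})$, $f(a)=\prod_{i\in a}x_i$, is injective and $\{f^{ -1}[A]:A\in p\}$ is an ordered union ultrafilter. $p$ is sparse if for every $A\in p$ there are a sequence $\vec{x}$ in $S$ and a subsequence $\vec{y}=(x_{k_n})_n$ ($k_0<k_1<\cdots$)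 with $\mathrm{FP}(\vec{y})\in p$, $\mathrm{FP}(\vec{x})\subseteq A$, and $\{k_n:n\in\omega\}$ coinfinite in $\omega$. -}

module Defs where

open import Algebra.Core using (Op₂)
open import Data.List.Base as List using ()
open import Data.List.Membership.Propositional using () renaming (_∈_ to _∈ᴸ_)
open import Data.List.NonEmpty.Base as List⁺ using (List⁺; _∷_; toList; foldr₁)
open import Data.List.Relation.Unary.Linked using (Linked)
open import Data.Nat.Base using (ℕ; suc; _<_; _≤_; _⊔_; _⊓_)
open import Data.Product.Base using (_×_; ∃-syntax; Σ-syntax)
open import Data.Sum.Base using (_⊎_)
open import Function.Base using (_∘_)
open import Function.Bundles using (_⤖_; Bijection)
open import Function.Definitions using (Injective)
open import Level as L using (Level; 0ℓ)
open import Relation.Binary.PropositionalEquality.Core using (_≡_)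
open import Relation.Unary
  using (Pred; _∈_; _∉_; _⊆_; _≐_; _∩_; _∪_; ∁; U; ∅; _⊢_)

private
  variable
    ℓ : Level
    A : Set

-- A subset of A is a predicate A → Set, and a family of subsets is a predicate
-- on those.  Families live at an arbitrary level because the family
-- { f⁻¹[ B ] : B ∈ p } below is defined by quantifying over subsets.
record IsUltrafilter {A : Set} (p : Pred (Pred A 0ℓ) ℓ) : Set (L.suc 0ℓ L.⊔ ℓ) where
  field
    full      : U ∈ p
    proper    : ∅ ∉ p
    upward    : ∀ {B C} → B ∈ p → B ⊆ C → C ∈ p
    intersect : ∀ {B C} → B ∈ p → C ∈ p → (B ∩ C) ∈ p
    ultra     : ∀ B → B ∈ p ⊎ ∁ B ∈ p

-- A finite nonempty subset of ω is represented by its increasing enumeration.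
-- Since the proof of monotonicity is irrelevant, two such sets have the same
-- members exactly when they are propositionally equal.
record 𝔽 : Set where
  constructor mk𝔽
  field
    elements    : List⁺ ℕ
    .increasing : Linked _<_ (toList elements)

open 𝔽 public

⟦_⟧ : 𝔽 → Pred ℕ 0ℓ
⟦ a ⟧ n = n ∈ᴸ toList (elements a)

max min : 𝔽 → ℕ
max a = foldr₁ _⊔_ (elements a)
min a = foldr₁ _⊓_ (elements a)

Ordered : (ℕ → 𝔽) → Set
Ordered b = ∀ n → max (b n) < min (b (suc n))

-- The partial operation of 𝔽 as a ternary relation: a ∙ b ↦ c says that the
-- product of a and b is defined and equals c.
_∙_↦_ : 𝔽 → 𝔽 → 𝔽 → Set
a ∙ b ↦ c = max a < min b × ⟦ c ⟧ ≐ ⟦ a ⟧ ∪ ⟦ b ⟧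

-- IsProduct𝔽 b (i₀ ∷ … ∷ iₖ) c says that the product b i₀ ⋯ b iₖ is defined
-- in 𝔽 and equals c.
data IsProduct𝔽 (b : ℕ → 𝔽) : List⁺ ℕ → 𝔽 → Set where
  single : ∀ {i} → IsProduct𝔽 b (i ∷ List.[]) (b i)
  cons   : ∀ {i j is c d} → IsProduct𝔽 b (j ∷ is) c → b i ∙ c ↦ d →
           IsProduct𝔽 b (i ∷ j List.∷ is) d

FP𝔽 : (ℕ → 𝔽) → Pred 𝔽 0ℓ
FP𝔽 b c = ∃[ a ] IsProduct𝔽 b (elements a) c

IsOrderedUnionUltrafilter : Pred (Pred 𝔽 0ℓ) ℓ → Set (L.suc 0ℓ L.⊔ ℓ)
IsOrderedUnionUltrafilter 𝒰 =
  IsUltrafilter 𝒰 ×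
  (∀ B → B ∈ 𝒰 → ∃[ b ] Ordered b × FP𝔽 b ∈ 𝒰 × FP𝔽 b ⊆ B)

-- The family { f⁻¹[ B ] : B ∈ p }, with subsets compared extensionally.
preimages : {B : Set} → (A → B) → Pred (Pred B 0ℓ) ℓ → Pred (Pred A 0ℓ) (L.suc 0ℓ L.⊔ ℓ)
preimages f p C = ∃[ B ] B ∈ p × C ≐ (f ⊢ B)

Infinite : Pred ℕ 0ℓ → Set
Infinite P = ∀ m → ∃[ n ] m ≤ n × n ∈ P

module _ {S : Set} (_·_ : Op₂ S) where

  ∏ : (ℕ → S) → 𝔽 → S
  ∏ x a = foldr₁ _·_ (List⁺.map x (elements a))

  FP : (ℕ → S) → Pred S 0ℓ
  FP x z = ∃[ a ] z ≡ ∏ x a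

  ProductSubsystem : (y x : ℕ → S) → Set
  ProductSubsystem y x = ∃[ a ] Ordered a × (∀ n → y n ≡ ∏ x (a n))

  VeryStronglyProductive : (s : ℕ → S) → Pred (Pred S 0ℓ) ℓ → Set (L.suc 0ℓ L.⊔ ℓ)
  VeryStronglyProductive s p =
    ∀ A → A ∈ p → ∃[ x ] ProductSubsystem x s × FP x ∈ p × FP x ⊆ A

  IsomorphicToOrderedUnion : Pred (Pred S 0ℓ) ℓ → Set (L.suc 0ℓ L.⊔ ℓ)
  IsomorphicToOrderedUnion p =
    ∃[ x ] Injective _≡_ _≡_ (∏ x) × IsOrderedUnionUltrafilter (preimages (∏ x) p)

  Sparse : Pred (Pred S 0ℓ) ℓ → Set (L.suc 0ℓ L.⊔ ℓ)
  Sparse p =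
    ∀ A → A ∈ p →
    Σ[ x ∈ (ℕ → S) ] Σ[ k ∈ (ℕ → ℕ) ]
      (∀ n → k n < k (suc n)) ×
      FP (x ∘ k) ∈ p ×
      FP x ⊆ A ×
      Infinite (∁ (λ j → ∃[ n ] j ≡ k n))

-- The free semigroup on X is List⁺ X with concatenation; an enumeration of X
-- gives the sequence of its generators.
generators : {X : Set} → ℕ ⤖ X → ℕ → List⁺ X
generators e n = List⁺.[ Bijection.to e n ]

{-# OPTIONS --safe #-}
-- The isomorphism is the generating sequence s itself: FP(s) ∈ p because p is
-- very strongly productive, and words are uniquely products of generators, so
-- ∏ s is a bijection from 𝔽 onto FP(s) that carries product subsystems to
-- ordered sequences.
--
-- For sparseness let FP(x) ∈ p be contained in A, and colour ∏ x a by the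
-- parity of the number of gaps in a, that is, of the consecutive elements
-- i < j of a with j ≠ i + 1.  Let y be a product subsystem of s with
-- FP(y) ∈ p monochromatic of colour c, where y n = ∏ x (α n).  For m < n,
-- joining α m to α n adds a gap precisely when max (α m) + 1 < min (α n), and
-- then c + c + 1 ≡ c (mod 2); otherwise c + c ≡ c.  Joining α 0 to α 2 does add
-- one, since α 1 lies between them, so c is odd, and hence joining α n to
-- α (n + 1) adds one for every n.  Interleaving y with the terms
-- x (max (α n) + 1) gives the required sequence.
module Submission where

open import Defs
open import Algebra.Core using (Op₂)
open import Algebra.Definitions using (Associative; Selective)
open import Data.Bool.Base using (Bool; true; false; not; _xor_)
open import Data.Bool.Properties using (xor-assoc)
open import Data.List.Base using (List; []; _∷_; _++_; concatMap)
open import Data.List.Membership.Propositional using (find; lose) renaming (_∈_ to _∈ᴸ_)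
open import Data.List.Membership.Propositional.Properties
  using (∈-++⁺ˡ; ∈-++⁺ʳ; ∈-++⁻)
open import Data.List.NonEmpty.Base as List⁺
  using (List⁺; _∷_; _⁺++⁺_; toList; head; foldr₁)
open import Data.List.NonEmpty.Properties using (⁺++⁺-assoc; map-⁺++⁺; ∷→∷⁺)
open import Data.List.Properties using (++-cancelˡ; ++-identityʳ; map-cong; ∷-injective)
open import Data.List.Relation.Unary.All as All using (All; []; _∷_)
open import Data.List.Relation.Unary.All.Properties as Allₚ using ()
open import Data.List.Relation.Unary.AllPairs as AllPairs using (AllPairs; []; _∷_)
open import Data.List.Relation.Unary.AllPairs.Properties as AllPairsₚ using ()
open import Data.List.Relation.Unary.Any using (here; there)
open import Data.List.Relation.Unary.Any.Properties using (concatMap⁺; concatMap⁻)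
open import Data.List.Relation.Unary.Linked as Linked using (Linked; [-]; _∷_; linked?)
open import Data.List.Relation.Unary.Linked.Properties
  using (Linked⇒AllPairs; AllPairs⇒Linked)
open import Data.Nat.Base using (ℕ; zero; suc; _<_; _≤_; _⊔_; _⊓_; _≡ᵇ_; z≤n; s≤s; z<s; s<s)
open import Data.Nat.Properties
open import Data.Product.Base using (_×_; _,_; proj₁; proj₂; ∃-syntax)
open import Data.Sum.Base using (_⊎_; inj₁; inj₂; [_,_]′)
open import Function.Base using (_∘_)
open import Function.Bundles using (_⤖_; Bijection)
open import Function.Definitions using (Injective)
open import Level using (Level; 0ℓ)
open import Relation.Binary.Definitions using (tri<; tri≈; tri>)
open import Relation.Binary.PropositionalEquality
open import Relation.Nullary using (¬_; contradiction)
open import Relation.Nullary.Decidable using (recompute)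
open import Relation.Unary using (Pred; _∈_; _⊆_; _≐_; ∁; U; _⊢_)

-- Finite subsets of ω

sorted : ∀ a → AllPairs _<_ (toList (elements a))
-- The irrelevant proof becomes usable because linkedness under `<` is decidable.
sorted (mk𝔽 _ inc) = Linked⇒AllPairs <-trans (recompute (linked? _<?_ _) inc)

elements-injective : Injective _≡_ _≡_ elements
elements-injective {mk𝔽 _ _} {mk𝔽 _ _} refl = refl

-- Each head is the least member of the common set, so the heads agree. It does not recur in a
-- strictly increasing list, so the tails again have the same members.
sorted-extensional : ∀ {xs ys} → AllPairs _<_ xs → AllPairs _<_ ys →
  (_∈ᴸ xs) ≐ (_∈ᴸ ys) → xs ≡ ys
sorted-extensional [] [] _ = refl
sorted-extensional [] (_ ∷ _) (_ , ⊇) with () ← ⊇ (here refl)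
sorted-extensional (_ ∷ _) [] (⊆ , _) with () ← ⊆ (here refl)
sorted-extensional {x ∷ xs} {y ∷ ys} (x<xs ∷ ixs) (y<ys ∷ iys) (⊆ , ⊇) =
  cong₂ _∷_ x≡y (sorted-extensional ixs iys
    ( (λ i∈xs → drop (subst (_< _) x≡y (All.lookup x<xs i∈xs)) (⊆ (there i∈xs)))
    , (λ i∈ys → drop (subst (_< _) (sym x≡y) (All.lookup y<ys i∈ys)) (⊇ (there i∈ys)))))
  where
  drop : ∀ {i j : ℕ} {js} → j < i → i ∈ᴸ j ∷ js → i ∈ᴸ js
  drop j<i (here refl) = contradiction j<i (<-irrefl refl)
  drop _   (there i∈)  = i∈

  x≡y : x ≡ y
  x≡y with ⊆ (here refl) | ⊇ (here refl)
  ... | here eq    | _          = eq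
  ... | there _    | here eq    = sym eq
  ... | there x∈ys | there y∈xs =
    contradiction (All.lookup x<xs y∈xs) (<-asym (All.lookup y<ys x∈ys))

𝔽-extensional : ∀ {a b} → ⟦ a ⟧ ≐ ⟦ b ⟧ → a ≡ b
𝔽-extensional {a} {b} a≐b =
  elements-injective (∷→∷⁺ (sorted-extensional (sorted a) (sorted b) a≐b))

foldr₁-selective : ∀ {A : Set} {f : Op₂ A} → Selective _≡_ f →
  ∀ xs → foldr₁ f xs ∈ᴸ toList xs
foldr₁-selective {A} {f} sel (x ∷ xs) = go x xs
  where
  go : ∀ x xs → foldr₁ f (x ∷ xs) ∈ᴸ x ∷ xs
  go x []       = here refl
  go x (y ∷ ys) with sel x (foldr₁ f (y ∷ ys))
  ... | inj₁ eq = here eq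
  ... | inj₂ eq = there (subst (_∈ᴸ _) (sym eq) (go y ys))

min∈ : ∀ a → ⟦ a ⟧ (min a)
min∈ a = foldr₁-selective ⊓-sel (elements a)

max∈ : ∀ a → ⟦ a ⟧ (max a)
max∈ a = foldr₁-selective ⊔-sel (elements a)

min≤ : ∀ a {i} → ⟦ a ⟧ i → min a ≤ i
min≤ (mk𝔽 (x ∷ xs) _) = go x xs
  where
  go : ∀ x xs {i} → i ∈ᴸ x ∷ xs → foldr₁ _⊓_ (x ∷ xs) ≤ i
  go x []       (here refl) = ≤-refl
  go x (y ∷ ys) (here refl) = m⊓n≤m x _
  go x (y ∷ ys) (there i∈)  = ≤-trans (m⊓n≤n x _) (go y ys i∈)

≤max : ∀ a {i} → ⟦ a ⟧ i → i ≤ max a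
≤max (mk𝔽 (x ∷ xs) _) = go x xs
  where
  go : ∀ x xs {i} → i ∈ᴸ x ∷ xs → i ≤ foldr₁ _⊔_ (x ∷ xs)
  go x []       (here refl) = ≤-refl
  go x (y ∷ ys) (here refl) = m≤m⊔n x _
  go x (y ∷ ys) (there i∈)  = ≤-trans (go y ys i∈) (m≤n⊔m x _)

min≤max : ∀ a → min a ≤ max a
min≤max a = min≤ a (max∈ a)

ordered-< : ∀ b → Ordered b → ∀ {i j} → i < j → max (b i) < min (b j)
ordered-< b ob {i} {suc j} i<1+j with m<1+n⇒m<n∨m≡n i<1+j
... | inj₁ i<j  = <-≤-trans (ordered-< b ob i<j) (≤-trans (min≤max (b j)) (<⇒≤ (ob j)))
... | inj₂ refl = ob i

ordered-separated : ∀ b → Ordered b → ∀ {i j m n} → i < j → ⟦ b i ⟧ m → ⟦ b j ⟧ n → m < n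
ordered-separated b ob {i} {j} i<j m∈ n∈ =
  ≤-<-trans (≤max (b i) m∈) (<-≤-trans (ordered-< b ob i<j) (min≤ (b j) n∈))

ordered-disjoint : ∀ b → Ordered b → ∀ {i j n} → ⟦ b i ⟧ n → ⟦ b j ⟧ n → i ≡ j
ordered-disjoint b ob {i} {j} n∈i n∈j with <-cmp i j
... | tri≈ _ i≡j _ = i≡j
... | tri< i<j _ _ = contradiction (ordered-separated b ob i<j n∈i n∈j) (<-irrefl refl)
... | tri> _ _ j<i = contradiction (ordered-separated b ob j<i n∈j n∈i) (<-irrefl refl)

singleton : ℕ → 𝔽
singleton n = mk𝔽 (n ∷ []) [-]

pair : ∀ {m n} → m < n → 𝔽
pair {m} {n} m<n = mk𝔽 (m ∷ n ∷ []) (m<n ∷ [-])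

-- Products

∏-cong : ∀ {S : Set} (_·_ : Op₂ S) {x y : ℕ → S} → x ≗ y → ∀ a → ∏ _·_ x a ≡ ∏ _·_ y a
∏-cong _·_ x≗y a = cong (foldr₁ _·_) (∷→∷⁺ (map-cong x≗y (toList (elements a))))

toList-∏ : ∀ {A : Set} (f : ℕ → List⁺ A) a →
  toList (∏ _⁺++⁺_ f a) ≡ concatMap (toList ∘ f) (toList (elements a))
toList-∏ f (mk𝔽 (i ∷ is) _) = go i is
  where
  go : ∀ i is → toList (foldr₁ _⁺++⁺_ (List⁺.map f (i ∷ is))) ≡ concatMap (toList ∘ f) (i ∷ is)
  go i []       = sym (++-identityʳ _)
  go i (j ∷ is) = cong (toList (f i) ++_) (go j is)

-- The first letter of the concatenation is the head of the first block and so determines the first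
-- index; that block is then cancelled.
concatMap-injective : ∀ {A B : Set} {f : A → List⁺ B} → Injective _≡_ _≡_ (head ∘ f) →
  Injective _≡_ _≡_ (concatMap (toList ∘ f))
concatMap-injective inj {[]}     {[]}     _  = refl
concatMap-injective {f = f} inj {x ∷ xs} {y ∷ ys} eq
  with refl ← inj {x} {y} (proj₁ (∷-injective eq)) =
  cong (x ∷_) (concatMap-injective inj (++-cancelˡ (toList (f x)) _ _ eq))

-- Asking only for distinct heads covers both the generators and every product subsystem of them.
∏-injective : ∀ {A : Set} {f : ℕ → List⁺ A} → Injective _≡_ _≡_ (head ∘ f) →
  Injective _≡_ _≡_ (∏ _⁺++⁺_ f)
∏-injective {f = f} inj {a} {b} eq = elements-injective (∷→∷⁺ (concatMap-injective inj
  (trans (sym (toList-∏ f a)) (trans (cong toList eq) (toList-∏ f b)))))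

head-∏ : ∀ {A : Set} (f : ℕ → List⁺ A) a → head (∏ _⁺++⁺_ f a) ≡ head (f (head (elements a)))
head-∏ f (mk𝔽 (_ ∷ [])    _) = refl
head-∏ f (mk𝔽 (_ ∷ _ ∷ _) _) = refl

⋃-sorted : ∀ b → Ordered b → ∀ a → AllPairs _<_ (toList (∏ _⁺++⁺_ (elements ∘ b) a))
⋃-sorted b ob a rewrite toList-∏ (elements ∘ b) a = AllPairsₚ.concat⁺
  (Allₚ.map⁺ (All.universal (sorted ∘ b) _))
  (AllPairsₚ.map⁺ (AllPairs.map separated (sorted a)))
  where
  separated : ∀ {i j} → i < j →
    All (λ m → All (m <_) (toList (elements (b j)))) (toList (elements (b i)))
  separated {i} {j} i<j = All.tabulate λ m∈ → All.tabulate λ n∈ →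
    ordered-separated b ob i<j m∈ n∈

-- The union of the blocks `b i` over `i` in `a`, formed as a product in the free semigroup on ω:
-- since the blocks are ordered, concatenating their enumerations already gives an increasing list.
⋃ : ∀ b → Ordered b → 𝔽 → 𝔽
⋃ b ob a = mk𝔽 (∏ _⁺++⁺_ (elements ∘ b) a) (AllPairs⇒Linked (⋃-sorted b ob a))

∈-⋃⁺ : ∀ b (ob : Ordered b) a {i n} → ⟦ a ⟧ i → ⟦ b i ⟧ n → ⟦ ⋃ b ob a ⟧ n
∈-⋃⁺ b ob a {n = n} i∈a n∈bᵢ =
  subst (n ∈ᴸ_) (sym (toList-∏ (elements ∘ b) a))
    (concatMap⁺ (toList ∘ elements ∘ b) (lose i∈a n∈bᵢ))

∈-⋃⁻ : ∀ b (ob : Ordered b) a {n} → ⟦ ⋃ b ob a ⟧ n → ∃[ i ] ⟦ a ⟧ i × ⟦ b i ⟧ n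
∈-⋃⁻ b ob a {n} n∈ = find (concatMap⁻ (toList ∘ elements ∘ b)
  (subst (n ∈ᴸ_) (toList-∏ (elements ∘ b) a) n∈))

-- If `min a′ ≤ max a`, then `b (min a′)` ends no later than `b (max a)`, yet the first lies in the
-- later union and the second in the earlier one.
⋃-reflects-< : ∀ b (ob : Ordered b) a a′ → max (⋃ b ob a) < min (⋃ b ob a′) → max a < min a′
⋃-reflects-< b ob a a′ lt = ≰⇒> λ j≤i →
  contradiction max<min (≤⇒≯ (≤-trans (min≤max (b (min a′))) (max-mono j≤i)))
  where
  max<min : max (b (max a)) < min (b (min a′))
  max<min = ≤-<-trans (≤max (⋃ b ob a) (∈-⋃⁺ b ob a (max∈ a) (max∈ (b (max a)))))
    (<-≤-trans lt (min≤ (⋃ b ob a′) (∈-⋃⁺ b ob a′ (min∈ a′) (min∈ (b (min a′))))))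

  max-mono : ∀ {i j} → j ≤ i → max (b j) ≤ max (b i)
  max-mono {i} j≤i with m≤n⇒m<n∨m≡n j≤i
  ... | inj₁ j<i  = ≤-trans (<⇒≤ (ordered-< b ob j<i)) (min≤max (b i))
  ... | inj₂ refl = ≤-refl

-- With `isProduct-unique`, this identifies `FP𝔽 b` with the range of `⋃ b ob`.
⋃-isProduct : ∀ b (ob : Ordered b) a → IsProduct𝔽 b (elements a) (⋃ b ob a)
⋃-isProduct b ob (mk𝔽 (i ∷ is) inc) = go i is inc
  where
  go : ∀ i is .(inc : Linked _<_ (i ∷ is)) → IsProduct𝔽 b (i ∷ is) (⋃ b ob (mk𝔽 (i ∷ is) inc))
  go i []       _   = single
  go i (j ∷ is) inc = cons (go j is (Linked.tail inc)) (b<⋃ , ∈-++⁻ bᵢ , [ ∈-++⁺ˡ , ∈-++⁺ʳ bᵢ ]′)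
    where
    bᵢ : List ℕ
    bᵢ = toList (elements (b i))

    rest : 𝔽
    rest = mk𝔽 (j ∷ is) (Linked.tail inc)

    b<⋃ : max (b i) < min (⋃ b ob rest)
    b<⋃ with k , k∈ , m∈ ← ∈-⋃⁻ b ob rest (min∈ (⋃ b ob rest)) =
      <-≤-trans (ordered-< b ob (All.lookup (AllPairs.head (sorted (mk𝔽 (i ∷ j ∷ is) inc))) k∈))
        (min≤ (b k) m∈)

isProduct-unique : ∀ {b is c d} → IsProduct𝔽 b is c → IsProduct𝔽 b is d → c ≡ d
isProduct-unique single single = refl
isProduct-unique (cons p (_ , ⊆ , ⊇)) (cons q (_ , ⊆′ , ⊇′)) with refl ← isProduct-unique p q =
  𝔽-extensional ((λ n∈ → ⊇′ (⊆ n∈)) , (λ n∈ → ⊇ (⊆′ n∈)))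

module _ {S : Set} {_·_ : Op₂ S} (assoc : Associative _≡_ _·_) where

  foldr₁-⁺++⁺ : ∀ xs ys → foldr₁ _·_ (xs ⁺++⁺ ys) ≡ foldr₁ _·_ xs · foldr₁ _·_ ys
  foldr₁-⁺++⁺ (x ∷ xs) ys = go x xs
    where
    go : ∀ x xs → foldr₁ _·_ ((x ∷ xs) ⁺++⁺ ys) ≡ foldr₁ _·_ (x ∷ xs) · foldr₁ _·_ ys
    go x []        = refl
    go x (x′ ∷ xs) = trans (cong (x ·_) (go x′ xs)) (sym (assoc x _ _))

  -- Generalised associativity: bracketing a long product block by block does not change it.
  ∏-⋃ : ∀ (x : ℕ → S) b (ob : Ordered b) a → ∏ _·_ x (⋃ b ob a) ≡ ∏ _·_ (∏ _·_ x ∘ b) a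
  ∏-⋃ x b ob (mk𝔽 (i ∷ is) _) = go i is
    where
    go : ∀ i is → foldr₁ _·_ (List⁺.map x (foldr₁ _⁺++⁺_ (List⁺.map (elements ∘ b) (i ∷ is))))
                ≡ foldr₁ _·_ (List⁺.map (∏ _·_ x ∘ b) (i ∷ is))
    go i []       = refl
    go i (j ∷ is) = trans (cong (foldr₁ _·_) (map-⁺++⁺ x (elements (b i)) _))
      (trans (foldr₁-⁺++⁺ (List⁺.map x (elements (b i))) _) (cong (∏ _·_ x (b i) ·_) (go j is)))

  ∏-subsystem : ∀ {x y : ℕ → S} b (ob : Ordered b) → (∀ n → y n ≡ ∏ _·_ x (b n)) →
    ∀ a → ∏ _·_ y a ≡ ∏ _·_ x (⋃ b ob a)
  ∏-subsystem {x} b ob y≗ a = trans (∏-cong _·_ y≗ a) (sym (∏-⋃ x b ob a))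

  FP-subsystem : ∀ {x y : ℕ → S} → ProductSubsystem _·_ y x → FP _·_ y ⊆ FP _·_ x
  FP-subsystem (b , ob , y≗) (a , refl) = ⋃ b ob a , ∏-subsystem b ob y≗ a

-- Ultrafilters

module _ {ℓ} {A B : Set} {f : A → B} (f-injective : Injective _≡_ _≡_ f)
  {p : Pred (Pred B 0ℓ) ℓ} (ultrafilter : IsUltrafilter p)
  (range∈p : (λ z → ∃[ a ] z ≡ f a) ∈ p) where

  open IsUltrafilter ultrafilter

  private
    image : Pred A 0ℓ → Pred B 0ℓ
    image C z = ∃[ a ] z ≡ f a × C a

    image⁺ : ∀ C → C ⊆ (f ⊢ image C)
    image⁺ C c = _ , refl , c

    image⁻ : ∀ C → (f ⊢ image C) ⊆ C
    image⁻ C (_ , eq , c) = subst C (sym (f-injective eq)) c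

  -- By injectivity every `C` is the preimage of its image. Members of `p` can be cut down to the
  -- range of `f`, where they are determined by their preimages.
  preimages-isUltrafilter : IsUltrafilter (preimages f p)
  preimages-isUltrafilter = record
    { full      = U , full , (λ _ → _) , (λ _ → _)
    ; proper    = λ (_ , D∈p , _ , ⊇) →
        proper (upward (intersect D∈p range∈p) λ { (d , _ , refl) → ⊇ d })
    ; upward    = λ { {C} {C′} (D , D∈p , _ , ⊇) C⊆C′ →
        image C′
        , upward (intersect D∈p range∈p) (λ { (d , a , refl) → a , refl , C⊆C′ (⊇ d) })
        , image⁺ C′ , image⁻ C′ }
    ; intersect = λ (_ , D∈p , ⊆ , ⊇) (_ , D′∈p , ⊆′ , ⊇′) →
        _ , intersect D∈p D′∈p , (λ (c , c′) → ⊆ c , ⊆′ c′) , (λ (d , d′) → ⊇ d , ⊇′ d′)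
    ; ultra     = decide
    }
    where
    decide : ∀ C → C ∈ preimages f p ⊎ ∁ C ∈ preimages f p
    decide C with ultra (image C)
    ... | inj₁ h = inj₁ (image C , h , image⁺ C , image⁻ C)
    ... | inj₂ h = inj₂ (∁ (image C) , h , (λ ¬c d → ¬c (image⁻ C d)) , (λ ¬d c → ¬d (image⁺ C c)))

-- Gaps

gap : ℕ → ℕ → Bool
gap i j = not (suc i ≡ᵇ j)

gap⁺ : ∀ {i j} → suc i < j → gap i j ≡ true
gap⁺ {zero}  {suc (suc j)} _       = refl
gap⁺ {zero}  {suc zero}    (s≤s ())
gap⁺ {suc i} {suc j}       (s≤s p) = gap⁺ p

-- The hypothesis `i < j` excludes `j ≤ i`, where `gap` is also `true`.
gap⁻ : ∀ {i j} → i < j → gap i j ≡ true → suc i < j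
gap⁻ {zero}  {suc (suc j)} _       _  = s<s z<s
gap⁻ {suc i} {suc j}       (s<s p) eq = s<s (gap⁻ p eq)

gapParity : List ℕ → Bool
gapParity []           = false
gapParity (i ∷ [])     = false
gapParity (i ∷ j ∷ is) = gap i j xor gapParity (j ∷ is)

-- The gaps of the concatenation are those inside `a`, those inside `b`, and possibly one at the
-- junction.
gapParity-++ : ∀ a b → gapParity (toList (elements a ⁺++⁺ elements b)) ≡
  gapParity (toList (elements a)) xor (gap (max a) (min b) xor gapParity (toList (elements b)))
gapParity-++ a@(mk𝔽 (i ∷ is) _) b@(mk𝔽 (j ∷ js) _) = trans (go i is (sorted a))
  (cong (λ m → gapParity (i ∷ is) xor (gap (max a) m xor gapParity (j ∷ js))) j≡min)
  where
  j≡min : j ≡ min b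
  j≡min with min∈ b
  ... | here eq  = sym eq
  ... | there m∈ =
    contradiction (min≤ b (here refl)) (<⇒≱ (All.lookup (AllPairs.head (sorted b)) m∈))

  go : ∀ i is → AllPairs _<_ (i ∷ is) → gapParity (i ∷ is ++ j ∷ js) ≡
    gapParity (i ∷ is) xor (gap (foldr₁ _⊔_ (i ∷ is)) j xor gapParity (j ∷ js))
  go i []       _            = refl
  go i (k ∷ ks) (i<ks ∷ iks) = begin
    gap i k xor gapParity (k ∷ ks ++ j ∷ js)
      ≡⟨ cong (gap i k xor_) (go k ks iks) ⟩
    gap i k xor (gapParity (k ∷ ks) xor (gap (foldr₁ _⊔_ (k ∷ ks)) j xor gapParity (j ∷ js)))
      ≡⟨ xor-assoc (gap i k) _ _ ⟨
    gapParity (i ∷ k ∷ ks) xor (gap (foldr₁ _⊔_ (k ∷ ks)) j xor gapParity (j ∷ js))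
      ≡⟨ cong (λ m → gapParity (i ∷ k ∷ ks) xor (gap m j xor gapParity (j ∷ js))) (m≤n⇒m⊔n≡n
           (<⇒≤ (All.lookup i<ks (foldr₁-selective ⊔-sel (k ∷ ks))))) ⟨
    gapParity (i ∷ k ∷ ks) xor (gap (foldr₁ _⊔_ (i ∷ k ∷ ks)) j xor gapParity (j ∷ js)) ∎
    where open ≡-Reasoning

-- The two copies of `c` cancel, leaving `g`. Here `c` is the colour of two blocks and of their
-- join, and `g` records the gap at the junction.
xor-idempotent⇒≡ : ∀ c g → c xor (g xor c) ≡ c → g ≡ c
xor-idempotent⇒≡ false false _ = refl
xor-idempotent⇒≡ true  true  _ = refl

homogeneous⇒gaps : ∀ α (oα : Ordered α) {c} →
  (∀ n → gapParity (toList (elements (α n))) ≡ c) →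
  (∀ {m n} (m<n : m < n) → gapParity (toList (elements (⋃ α oα (pair m<n)))) ≡ c) →
  ∀ n → suc (max (α n)) < min (α (suc n))
homogeneous⇒gaps α oα {c} terms pairs n = gap⁻ (oα n) (trans (gap≡c (n<1+n n)) c≡true)
  where
  gap≡c : ∀ {m n} → m < n → gap (max (α m)) (min (α n)) ≡ c
  gap≡c {m} {n} m<n = xor-idempotent⇒≡ c _ (trans
    (cong₂ (λ u v → u xor (gap (max (α m)) (min (α n)) xor v)) (sym (terms m)) (sym (terms n)))
    (trans (sym (gapParity-++ (α m) (α n))) (pairs m<n)))

  c≡true : c ≡ true
  -- `z<s {1}` is `0 < 2`: the block `α 1` between the two forces a gap.
  c≡true = trans (sym (gap≡c (z<s {1})))
    (gap⁺ (≤-<-trans (≤-trans (oα 0) (min≤max (α 1))) (oα 1)))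

-- Interleaved sequences

interleave : ∀ {A : Set} → (ℕ → A) → (ℕ → A) → ℕ → A
interleave f g zero          = f 0
interleave f g (suc zero)    = g 0
interleave f g (suc (suc n)) = interleave (f ∘ suc) (g ∘ suc) n

-- The recursion in steps of two matches the last clause of `interleave`.
double : ℕ → ℕ
double zero    = zero
double (suc n) = suc (suc (double n))

interleave-double : ∀ {A : Set} (f g : ℕ → A) n → interleave f g (double n) ≡ f n
interleave-double f g zero    = refl
interleave-double f g (suc n) = interleave-double (f ∘ suc) (g ∘ suc) n

interleave-ordered : ∀ f g → (∀ n → max (f n) < min (g n)) →
  (∀ n → max (g n) < min (f (suc n))) → Ordered (interleave f g)
interleave-ordered f g f<g g<f zero          = f<g 0
interleave-ordered f g f<g g<f (suc zero)    = g<f 0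
interleave-ordered f g f<g g<f (suc (suc n)) =
  interleave-ordered (f ∘ suc) (g ∘ suc) (f<g ∘ suc) (g<f ∘ suc) n

double-coinfinite : Infinite (∁ (λ j → ∃[ n ] j ≡ double n))
double-coinfinite m = suc (double m) , m≤1+double m , λ (n , eq) → odd≢even m n eq
  where
  m≤1+double : ∀ m → m ≤ suc (double m)
  m≤1+double zero    = z≤n
  m≤1+double (suc m) = s≤s (m≤n⇒m≤1+n (m≤1+double m))

  odd≢even : ∀ m n → ¬ suc (double m) ≡ double n
  odd≢even (suc m) (suc n) eq = odd≢even m n (suc-injective (suc-injective eq))

-- Very strongly productive ultrafilters on the free semigroup

module _ {ℓ} {X : Set} (e : ℕ ⤖ X) (p : Pred (Pred (List⁺ X) 0ℓ) ℓ)
  (ultrafilter : IsUltrafilter p)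
  (productive : VeryStronglyProductive _⁺++⁺_ (generators e) p) where

  open IsUltrafilter ultrafilter

  private
    s : ℕ → List⁺ X
    s = generators e

    Π : (ℕ → List⁺ X) → 𝔽 → List⁺ X
    Π = ∏ _⁺++⁺_

    Π-s-injective : Injective _≡_ _≡_ (Π s)
    Π-s-injective = ∏-injective (Bijection.injective e)

    -- The head of `x i` is the generator indexed by the first element of `b i`, and the blocks are
    -- disjoint, so distinct terms have distinct heads.
    subsystem-injective : ∀ {x} → ProductSubsystem _⁺++⁺_ x s → Injective _≡_ _≡_ (Π x)
    subsystem-injective {x} (b , ob , x≗) = ∏-injective λ {i} {j} eq →
      ordered-disjoint b ob {i} {j} {head (elements (b i))} (here refl)
        (here (Bijection.injective e (trans (sym (head-x i)) (trans eq (head-x j)))))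
      where
      head-x : ∀ i → head (x i) ≡ Bijection.to e (head (elements (b i)))
      head-x i = trans (cong head (x≗ i)) (head-∏ s (b i))

    FP-s∈p : FP _⁺++⁺_ s ∈ p
    FP-s∈p with x , x-subsystem , FPx∈p , _ ← productive U full =
      upward FPx∈p (FP-subsystem ⁺++⁺-assoc x-subsystem)

  isomorphicToOrderedUnion : IsomorphicToOrderedUnion _⁺++⁺_ p
  isomorphicToOrderedUnion =
    s , Π-s-injective , preimages-isUltrafilter Π-s-injective ultrafilter FP-s∈p , orderedUnion
    where
    orderedUnion : ∀ C → C ∈ preimages (Π s) p →
      ∃[ b ] Ordered b × FP𝔽 b ∈ preimages (Π s) p × FP𝔽 b ⊆ C
    orderedUnion C (D , D∈p , _ , ⊇)
      with x , (b , ob , x≗) , FPx∈p , FPx⊆D ← productive D D∈p =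
      -- The blocks that build `x` from `s` are the ordered sequence sought: `FP x` pulls back along
      -- `Π s` to exactly `FP𝔽 b`.
      b , ob , (FP _⁺++⁺_ x , FPx∈p , to , from) , λ c∈ → ⊇ (FPx⊆D (to c∈))
      where
      to : FP𝔽 b ⊆ (Π s ⊢ FP _⁺++⁺_ x)
      to (a , c-product) = a , trans (cong (Π s) (isProduct-unique c-product (⋃-isProduct b ob a)))
        (sym (∏-subsystem ⁺++⁺-assoc b ob x≗ a))

      from : (Π s ⊢ FP _⁺++⁺_ x) ⊆ FP𝔽 b
      from (a , eq) = a , subst (IsProduct𝔽 b (elements a))
        (sym (Π-s-injective (trans eq (∏-subsystem ⁺++⁺-assoc b ob x≗ a)))) (⋃-isProduct b ob a)

  private
    -- When `x` is a product subsystem of `s`, `subsystem-injective` makes `a`, and hence the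
    -- colour, unique.
    Coloured : (ℕ → List⁺ X) → Bool → Pred (List⁺ X) 0ℓ
    Coloured x c z = ∃[ a ] z ≡ Π x a × gapParity (toList (elements a)) ≡ c

    some-colour : ∀ {x} → FP _⁺++⁺_ x ∈ p → ∃[ c ] Coloured x c ∈ p
    some-colour {x} FPx∈p with ultra (Coloured x true)
    ... | inj₁ odd = true , odd
    -- Words outside `FP x` have no colour, hence the intersection with `FP x`.
    ... | inj₂ ¬odd = false , upward (intersect ¬odd FPx∈p) even
      where
      even : ∀ {z} → ¬ Coloured x true z × FP _⁺++⁺_ x z → Coloured x false z
      even (¬odd , a , eq) with gapParity (toList (elements a)) in parity
      ... | true  = contradiction (a , eq , parity) ¬odd
      ... | false = a , eq , parity

    -- Membership in `Coloured x c` yields the factors `α n` but not their order. The order is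
    -- inherited from `d`: unique factorisation over `s` gives `d n ≡ ⋃ b ob (α n)`, and such unions
    -- reflect the order.
    gapped-factors : ∀ {x y} {c} → ProductSubsystem _⁺++⁺_ x s → ProductSubsystem _⁺++⁺_ y s →
      FP _⁺++⁺_ y ⊆ Coloured x c →
      ∃[ α ] (∀ n → y n ≡ Π x (α n)) × (∀ n → suc (max (α n)) < min (α (suc n)))
    gapped-factors {x} {y} {c} x-subsystem@(b , ob , x≗) (d , od , y≗) FPy⊆ =
      α , y≗Πα , homogeneous⇒gaps α oα terms pairs
      where
      factor : ∀ a → Coloured x c (Π y a)
      factor a = FPy⊆ (a , refl)

      α : ℕ → 𝔽
      α n = proj₁ (factor (singleton n))

      y≗Πα : ∀ n → y n ≡ Π x (α n)
      y≗Πα n = proj₁ (proj₂ (factor (singleton n)))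

      d≗⋃α : ∀ n → d n ≡ ⋃ b ob (α n)
      d≗⋃α n = Π-s-injective (trans (sym (y≗ n))
        (trans (y≗Πα n) (∏-subsystem ⁺++⁺-assoc b ob x≗ (α n))))

      oα : Ordered α
      oα n = ⋃-reflects-< b ob (α n) (α (suc n))
        (subst₂ (λ u v → max u < min v) (d≗⋃α n) (d≗⋃α (suc n)) (od n))

      terms : ∀ n → gapParity (toList (elements (α n))) ≡ c
      terms n = proj₂ (proj₂ (factor (singleton n)))

      pairs : ∀ {m n} (m<n : m < n) → gapParity (toList (elements (⋃ α oα (pair m<n)))) ≡ c
      -- The set `a` that witnesses the colour of the two-term product is only known through its
      -- product; injectivity of `Π x` identifies it with the union of `α m` and `α n`.
      pairs m<n with a , eq , parity ← factor (pair m<n) = trans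
        (cong (gapParity ∘ toList ∘ elements)
          (subsystem-injective x-subsystem {⋃ α oα (pair m<n)} {a}
          (trans (sym (∏-subsystem ⁺++⁺-assoc α oα y≗Πα (pair m<n))) eq)))
        parity

  sparse : Sparse _⁺++⁺_ p
  sparse A A∈p
    with x , x-subsystem , FPx∈p , FPx⊆A ← productive A A∈p
    with c , coloured∈p ← some-colour FPx∈p
    with y , y-subsystem , FPy∈p , FPy⊆ ← productive (Coloured x c) coloured∈p
    with α , y≗ , gaps ← gapped-factors x-subsystem y-subsystem FPy⊆ =
    -- The even positions carry `y`, and the fillers at the odd positions make it coinfinite. All
    -- terms are products over `x`, which keeps their `FP` inside `A`.
    Π x ∘ β , double , (λ _ → m<n⇒m<1+n (n<1+n _)) ,
    upward FPy∈p (λ (a , eq) → a , trans eq (∏-cong _⁺++⁺_ y≗z a)) ,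
    (λ z∈ → FPx⊆A (FP-subsystem ⁺++⁺-assoc (β , oβ , λ _ → refl) z∈)) ,
    double-coinfinite
    where
    fillers : ℕ → 𝔽
    fillers n = singleton (suc (max (α n)))

    β : ℕ → 𝔽
    β = interleave α fillers

    oβ : Ordered β
    -- By `gaps`, the point just after `α n` still precedes `α (suc n)`.
    oβ = interleave-ordered α fillers (λ n → n<1+n (max (α n))) gaps

    y≗z : ∀ n → y n ≡ Π x (β (double n))
    y≗z n = trans (y≗ n) (cong (Π x) (sym (interleave-double α fillers n)))

mainTheorem17 : ∀ {ℓ : Level} {X : Set} (e : ℕ ⤖ X) (p : Pred (Pred (List⁺ X) 0ℓ) ℓ) →
    IsUltrafilter p →
    VeryStronglyProductive _⁺++⁺_ (generators e) p →
    IsomorphicToOrderedUnion _⁺++⁺_ p × Sparse _⁺++⁺_ p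
mainTheorem17 e p ultrafilter productive =
  isomorphicToOrderedUnion e p ultrafilter productive , sparse e p ultrafilter productive
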